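{- For all $a, b \in \mathbb{N}$, $R_\mathrm{ord}(K_a, S_b^\mathrm{sc}) = 1 + (a-1)(b-1)$.
   Context: All graphs are finite, simple and undirected, and a graph of order $n$ has vertex set $\{0,1,\ldots,n-1\}$; $K_n$ is the complete graph on $\{0,\ldots,n-1\}$. A $2$-edge-coloring of $K_n$ assigns each edge a color in $\{1,2\}$. For a graph $H$ and such a coloring, an embedding of $H$ in color $j$ is an injective map $\varphi\colon V(H)\to V(K_n)$ such that for every edge $uv$ of $H$ the edge $\{\varphi(u),\varphi(v)\}$ has color $j$; it is increasing if $\varphi(0)<\cdots<\varphi(|H|-1)$. The ordered Ramsey number $R_\mathrm{ord}(H_1,H_2)$ is the smallest $n$ such that every $2$-edge-coloring of $K_n$ admits an increasing embedding of $H_1$ in color $1$ or an increasing embedding of $H_2$ in color $2$. The start-central star $S_n^\mathrm{sc}$ is the graph of order $n$ whose edges are exactly $\{0,v\}$ for $1\le v\le n-1$. -}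

module Defs where

open import Data.Fin as Fin using (Fin; toℕ)
import Data.Fin.Properties as Fin
open import Data.Nat using (ℕ; _≤_; _≟_; _≤?_)
open import Data.Product using (Σ-syntax; _×_; _,_)
open import Data.Sum using (_⊎_; inj₁; inj₂; swap)
open import Function.Definitions using (Injective)
open import Level using (0ℓ)
open import Relation.Binary.Core using (Rel; _Preserves_⟶_)
open import Relation.Binary.Definitions using (Symmetric; Irreflexive; Decidable)
open import Relation.Binary.PropositionalEquality using (_≡_; _≢_; refl; sym)
open import Relation.Nullary using (¬_)
open import Relation.Nullary.Decidable using (¬?; _×-dec_; _⊎-dec_)

record Graph (n : ℕ) : Set₁ where
  field
    Adj    : Rel (Fin n) 0ℓ
    adj?   : Decidable Adj
    symm   : Symmetric Adj
    irrefl : Irreflexive _≡_ Adj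

open Graph public

K : ∀ n → Graph n
K n = record
  { Adj    = _≢_
  ; adj?   = λ u v → ¬? (u Fin.≟ v)
  ; symm   = λ u≢v v≡u → u≢v (sym v≡u)
  ; irrefl = λ u≡v u≢v → u≢v u≡v
  }

startCentralStar : ∀ n → Graph n
startCentralStar n = record
  { Adj    = λ u v → Arm u v ⊎ Arm v u
  ; adj?   = λ u v → arm? u v ⊎-dec arm? v u
  ; symm   = swap
  ; irrefl = λ { refl (inj₁ arm) → ¬loop arm ; refl (inj₂ arm) → ¬loop arm }
  }
  where
  Arm : Rel (Fin n) 0ℓ
  Arm u v = toℕ u ≡ 0 × 1 ≤ toℕ v

  arm? : Decidable Arm
  arm? u v = (toℕ u ≟ 0) ×-dec (1 ≤? toℕ v)

  ¬loop : ∀ {u} → ¬ Arm u u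
  ¬loop {Fin.zero}  (_ , ())
  ¬loop {Fin.suc _} (() , _)

data Colour : Set where
  colour₁ colour₂ : Colour

-- The colour of {u , v} may depend neither on the adjacency proof
-- (irrelevant argument) nor on the order of the endpoints (`unordered`).
record EdgeColouring {n} (G : Graph n) : Set where
  field
    colour    : ∀ u v → .(Adj G u v) → Colour
    unordered : ∀ u v .(e : Adj G u v) → colour u v e ≡ colour v u (symm G e)

open EdgeColouring public

record Embedding {k n} (H : Graph k) (χ : EdgeColouring (K n)) (j : Colour) : Set where
  field
    φ         : Fin k → Fin n
    injective : Injective _≡_ _≡_ φ

  edge : ∀ {u v} → Adj H u v → φ u ≢ φ v
  edge e φu≡φv = irrefl H (injective φu≡φv) e

  field
    coloured  : ∀ {u v} (e : Adj H u v) → colour χ (φ u) (φ v) (edge e) ≡ j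

open Embedding public

Increasing : ∀ {k n} {H : Graph k} {χ : EdgeColouring (K n)} {j} → Embedding H χ j → Set
Increasing f = φ f Preserves Fin._<_ ⟶ Fin._<_

IncreasingEmbedding : ∀ {k n} → Graph k → EdgeColouring (K n) → Colour → Set
IncreasingEmbedding H χ j = Σ[ f ∈ Embedding H χ j ] Increasing f

OrderedRamseyProperty : ∀ {k l} → Graph k → Graph l → ℕ → Set
OrderedRamseyProperty H₁ H₂ n =
  (χ : EdgeColouring (K n)) → IncreasingEmbedding H₁ χ colour₁ ⊎ IncreasingEmbedding H₂ χ colour₂

-- `IsLeast P r` with P the Ramsey property renders the equation R_ord(H₁ , H₂) = r.
IsLeast : (ℕ → Set) → ℕ → Set
IsLeast P r = P r × (∀ m → P m → r ≤ m)

R-ord[_,_]≡_ : ∀ {k l} → Graph k → Graph l → ℕ → Set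
R-ord[ H₁ , H₂ ]≡ r = IsLeast (OrderedRamseyProperty H₁ H₂) r

{-# OPTIONS --safe #-}

-- Write a = 1 + s and b = 1 + t.
--
-- Upper bound: induct on s over increasing lists of more than s * t vertices.  The first
-- vertex x either sends t edges of colour 2 to the right, giving the star, or sends more than
-- (s - 1) * t edges of colour 1 to the right, and x extends any clique found among their ends.
--
-- Lower bound: cut at most s * t vertices into s blocks of size at most t, and use colour 2
-- inside the blocks and colour 1 between them.  By pigeonhole, 1 + s vertices of a clique
-- cannot lie in distinct blocks, and 1 + t vertices of a star cannot lie in a common block.
module Submission where

open import Data.Bool using (if_then_else_)
open import Data.Fin as Fin using (Fin; inject≤; quotient; remainder)
import Data.Fin.Properties as Fin
open import Data.List using (List; []; _∷_; length; filter; lookup)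
open import Data.List.Membership.Propositional.Properties using (∈-lookup)
open import Data.List.Properties using (length-tabulate)
open import Data.List.Relation.Binary.Sublist.Propositional using (_⊆_; _∷_; minimum; ⊆-trans)
open import Data.List.Relation.Binary.Sublist.Propositional.Properties using (All-resp-⊆; filter-⊆)
open import Data.List.Relation.Unary.All as All using (All; []; _∷_)
open import Data.List.Relation.Unary.All.Properties using (all-filter)
open import Data.List.Relation.Unary.AllPairs using (AllPairs; []; _∷_)
import Data.List.Relation.Unary.AllPairs.Properties as AllPairs
open import Data.Nat using (ℕ; zero; suc; z≤n; s≤s; s≤s⁻¹; _<_; _≤?_; _+_; _*_; _∸_; _≤_)
open import Data.Nat.Properties using (≤-trans; ≤-reflexive; ≰⇒>; n<1+n; n≤1+n; +-comm; +-suc; +-monoˡ-≤; +-monoʳ-≤; +-cancelˡ-≤; module ≤-Reasoning)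
open import Data.Product using (Σ-syntax; ∃; ∃₂; _×_; _,_; proj₁; proj₂)
open import Data.Sum as Sum using (_⊎_; inj₁; inj₂; [_,_]′)
open import Function using (_∘_; id)
open import Level using (Level)
open import Relation.Binary.Core using (Rel; _Preserves_⟶_)
open import Relation.Binary.Definitions using (DecidableEquality; tri<; tri≈; tri>)
open import Relation.Binary.PropositionalEquality using (_≡_; _≢_; refl; sym; trans; cong₂; subst₂)
open import Relation.Nullary using (¬_; yes; no; does; contradiction)
open import Relation.Unary using (Pred; Decidable; _∪_)
open import Defs

private variable
  a p q ℓ : Level
  A : Set a
  k n s t : ℕ

length-filter-∪ : {P : Pred A p} {Q : Pred A q} (P? : Decidable P) (Q? : Decidable Q) →
  ∀ {xs} → All (P ∪ Q) xs → length xs ≤ length (filter P? xs) + length (filter Q? xs)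
length-filter-∪ P? Q? [] = z≤n
length-filter-∪ P? Q? {x ∷ xs} (px ∷ pxs) with ih ← length-filter-∪ P? Q? pxs | P? x | Q? x
-- An entry satisfying both predicates counts twice on the right; the surplus is absorbed by
-- `n≤1+n`.
... | yes _  | yes _  = s≤s (≤-trans ih (+-monoʳ-≤ (length (filter P? xs)) (n≤1+n _)))
... | yes _  | no _   = s≤s ih
... | no _   | yes _  = ≤-trans (s≤s ih) (≤-reflexive (sym (+-suc _ _)))
... | no ¬Px | no ¬Qx = contradiction px [ ¬Px , ¬Qx ]′

AllPairs-lookup : {R : Rel A ℓ} {xs : List A} → AllPairs R xs →
  ∀ {i j} → i Fin.< j → R (lookup xs i) (lookup xs j)
AllPairs-lookup (px ∷ _)  {Fin.zero}  {Fin.suc j} _         = All.lookup px (∈-lookup j)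
AllPairs-lookup (_ ∷ pxs) {Fin.suc i} {Fin.suc j} (s≤s i<j) = AllPairs-lookup pxs i<j

inject≤-mono-< : .(k≤n : k ≤ n) {i j : Fin k} → i Fin.< j → inject≤ i k≤n Fin.< inject≤ j k≤n
inject≤-mono-< k≤n {i} {j} =
  subst₂ _<_ (sym (Fin.toℕ-inject≤ i k≤n)) (sym (Fin.toℕ-inject≤ j k≤n))

_≟ᶜ_ : DecidableEquality Colour
colour₁ ≟ᶜ colour₁ = yes refl
colour₁ ≟ᶜ colour₂ = no λ ()
colour₂ ≟ᶜ colour₁ = no λ ()
colour₂ ≟ᶜ colour₂ = yes refl

colour₁⊎colour₂ : ∀ c → c ≡ colour₁ ⊎ c ≡ colour₂
colour₁⊎colour₂ colour₁ = inj₁ refl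
colour₁⊎colour₂ colour₂ = inj₂ refl

-- Order and colour are bundled, so that `AllPairs (Arc χ j)` describes an increasing clique of
-- colour `j`; the order also supplies the proof that the endpoints differ.
Arc : EdgeColouring (K n) → Colour → Rel (Fin n) _
Arc χ j u v = Σ[ u<v ∈ u Fin.< v ] colour χ u v (Fin.<⇒≢ u<v) ≡ j

module _ (χ : EdgeColouring (K n)) where

  arc? : ∀ j u → Decidable (Arc χ j u)
  arc? j u v with u Fin.<? v
  ... | no u≮v = no (u≮v ∘ proj₁)
  ... | yes u<v with colour χ u v (Fin.<⇒≢ u<v) ≟ᶜ j
  ...   | yes eq = yes (u<v , eq)
  ...   | no neq = no (neq ∘ proj₂)

  arc-cover : ∀ {u v} → u Fin.< v → Arc χ colour₁ u v ⊎ Arc χ colour₂ u v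
  arc-cover {u} {v} u<v = Sum.map (u<v ,_) (u<v ,_) (colour₁⊎colour₂ (colour χ u v (Fin.<⇒≢ u<v)))

  -- Ascending edges suffice: a strictly increasing map is injective, and a descending edge is
  -- reversed by `symm` and `unordered`.
  increasingEmbedding : ∀ {H : Graph k} {j} (f : Fin k → Fin n) → f Preserves Fin._<_ ⟶ Fin._<_ →
    (∀ {u v} → u Fin.< v → Adj H u v → Arc χ j (f u) (f v)) → IncreasingEmbedding H χ j
  increasingEmbedding {H = H} {j} f f-mono f-arc =
    record { φ = f ; injective = f-injective ; coloured = f-coloured } , f-mono
    where
    f-injective : ∀ {u v} → f u ≡ f v → u ≡ v
    f-injective {u} {v} fu≡fv with Fin.<-cmp u v
    ... | tri< u<v _ _ = contradiction fu≡fv (Fin.<⇒≢ (f-mono u<v))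
    ... | tri≈ _ u≡v _ = u≡v
    ... | tri> _ _ v<u = contradiction (sym fu≡fv) (Fin.<⇒≢ (f-mono v<u))

    f-coloured : ∀ {u v} (e : Adj H u v) →
      colour χ (f u) (f v) (λ fu≡fv → irrefl H (f-injective fu≡fv) e) ≡ j
    f-coloured {u} {v} e with Fin.<-cmp u v
    ... | tri< u<v _ _ = proj₂ (f-arc u<v e)
    ... | tri≈ _ u≡v _ = contradiction e (irrefl H u≡v)
    ... | tri> _ _ v<u = trans (unordered χ (f u) (f v) _) (proj₂ (f-arc v<u (symm H e)))

  K-embedding : ∀ {xs} {j} → AllPairs (Arc χ j) xs → k ≤ length xs → IncreasingEmbedding (K k) χ j
  K-embedding {xs = xs} arcs k≤ =
    increasingEmbedding (λ i → lookup xs (inject≤ i k≤)) (proj₁ ∘ arc) (λ u<v _ → arc u<v)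
    where
    arc : ∀ {u v} → u Fin.< v → Arc χ _ (lookup xs (inject≤ u k≤)) (lookup xs (inject≤ v k≤))
    arc = AllPairs-lookup arcs ∘ inject≤-mono-< k≤

  star-embedding : ∀ {x xs} {j} → AllPairs Fin._<_ xs → All (Arc χ j x) xs →
    k ≤ suc (length xs) → IncreasingEmbedding (startCentralStar k) χ j
  star-embedding {k = k} {x} {xs} {j} sorted arcs k≤ =
    increasingEmbedding f
      (AllPairs-lookup (All.map proj₁ arcs ∷ sorted) ∘ inject≤-mono-< k≤) arc
    where
    f : Fin k → Fin n
    f i = lookup (x ∷ xs) (inject≤ i k≤)

    arc : ∀ {u v} → u Fin.< v → Adj (startCentralStar k) u v → Arc χ j (f u) (f v)
    -- Position 0 holds the centre `x`, so leaf `suc v` sits at index `v` of `xs`. The remaining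
    -- cases would be edges leaving a leaf to the right.
    arc {Fin.zero}  {Fin.suc v} _  _                = All.lookup arcs (∈-lookup (inject≤ v (s≤s⁻¹ k≤)))
    arc {Fin.suc _} {_}         _  (inj₁ (() , _))
    arc {Fin.suc _} {Fin.suc _} _  (inj₂ (() , _))

  -- The conclusion `ys ⊆ xs` serves the induction: a clique found among the colour 1 neighbours of
  -- `x` inherits from them the arcs from `x`.
  clique-or-star : ∀ s t {xs} → AllPairs Fin._<_ xs → s * t < length xs →
    (∃ λ ys → ys ⊆ xs × AllPairs (Arc χ colour₁) ys × s < length ys) ⊎
    (∃₂ λ x ys → AllPairs Fin._<_ ys × All (Arc χ colour₂ x) ys × t ≤ length ys)
  -- Here `xs` is only known to be nonempty, and one vertex is already a clique with more than 0
  -- vertices.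
  clique-or-star zero t {x ∷ xs} _ _ = inj₁ (x ∷ [] , refl ∷ minimum xs , [] ∷ [] , s≤s z≤n)
  -- Removing `x` weakens the strict bound to `t + s * t ≤ length xs`; strictness returns below from
  -- `l₂ < t`.
  clique-or-star (suc s) t {x ∷ xs} (x<xs ∷ sorted) (s≤s t+st≤) with t ≤? length (filter (arc? colour₂ x) xs)
  ... | yes t≤ = inj₂ (x , _ , AllPairs.filter⁺ (arc? colour₂ x) sorted , all-filter (arc? colour₂ x) xs , t≤)
  ... | no t≰ with clique-or-star s t (AllPairs.filter⁺ (arc? colour₁ x) sorted) st<
    where
    l₁ l₂ : ℕ
    l₁ = length (filter (arc? colour₁ x) xs)
    l₂ = length (filter (arc? colour₂ x) xs)

    open ≤-Reasoning
    st< : s * t < l₁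
    st< = +-cancelˡ-≤ l₂ _ _ (begin
      l₂ + suc (s * t)  ≡⟨ +-suc l₂ (s * t) ⟩
      suc l₂ + s * t    ≤⟨ +-monoˡ-≤ (s * t) (≰⇒> t≰) ⟩
      t + s * t         ≤⟨ t+st≤ ⟩
      length xs         ≤⟨ length-filter-∪ (arc? colour₁ x) (arc? colour₂ x) (All.map arc-cover x<xs) ⟩
      l₁ + l₂           ≡⟨ +-comm l₁ l₂ ⟩
      l₂ + l₁           ∎)
  ...   | inj₂ star = inj₂ star
  ...   | inj₁ (ys , ys⊆ , arcs , s<) =
    inj₁ ( x ∷ ys
         , refl ∷ ⊆-trans ys⊆ (filter-⊆ (arc? colour₁ x) xs)
         , All-resp-⊆ ys⊆ (all-filter (arc? colour₁ x) xs) ∷ arcs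
         , s≤s s< )

orderedRamseyProperty : s * t < n → OrderedRamseyProperty (K (suc s)) (startCentralStar (suc t)) n
orderedRamseyProperty {s} {t} {n} st<n χ
  -- The list is that of all `n` vertices in order.
  with clique-or-star χ s t (AllPairs.tabulate⁺-< {f = id} id)
         (≤-trans st<n (≤-reflexive (sym (length-tabulate id))))
... | inj₁ (_ , _ , arcs , s<)        = inj₁ (K-embedding χ arcs s<)
... | inj₂ (_ , _ , sorted , arcs , t≤) = inj₂ (star-embedding χ sorted arcs (s≤s t≤))

blockColouring : (Fin n → Fin s) → EdgeColouring (K n)
blockColouring block = record
  { colour    = λ u v _ → if does (block u Fin.≟ block v) then colour₂ else colour₁
  ; unordered = λ u v _ → symmetric (block u) (block v)
  }
  where
  symmetric : ∀ x y → (if does (x Fin.≟ y) then colour₂ else colour₁) ≡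
                      (if does (y Fin.≟ x) then colour₂ else colour₁)
  symmetric x y with x Fin.≟ y | y Fin.≟ x
  ... | yes _   | yes _   = refl
  ... | no _    | no _    = refl
  ... | yes x≡y | no y≢x  = contradiction (sym x≡y) y≢x
  ... | no x≢y  | yes y≡x = contradiction (sym y≡x) x≢y

module _ (block : Fin n → Fin s) where

  colour₁⇒≢ : ∀ {u v} .(e : u ≢ v) → colour (blockColouring block) u v e ≡ colour₁ → block u ≢ block v
  colour₁⇒≢ {u} {v} _ eq with block u Fin.≟ block v
  colour₁⇒≢ _ _  | no bu≢bv = bu≢bv
  colour₁⇒≢ _ () | yes _

  colour₂⇒≡ : ∀ {u v} .(e : u ≢ v) → colour (blockColouring block) u v e ≡ colour₂ → block u ≡ block v
  colour₂⇒≡ {u} {v} _ eq with block u Fin.≟ block v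
  colour₂⇒≡ _ _  | yes bu≡bv = bu≡bv
  colour₂⇒≡ _ () | no _

  blockColouring-¬K : s < k → ¬ Embedding (K k) (blockColouring block) colour₁
  blockColouring-¬K s<k f with i , j , i<j , eq ← Fin.pigeonhole s<k (block ∘ φ f) =
    colour₁⇒≢ (edge f (Fin.<⇒≢ i<j)) (coloured f (Fin.<⇒≢ i<j)) eq

  -- Colour 2 puts every leaf in the block of the centre. Since `position` separates vertices within
  -- a block and takes `t` values, that block is too small for `1 + t` vertices.
  blockColouring-¬star : (position : Fin n → Fin t) →
    (∀ {u v} → block u ≡ block v → position u ≡ position v → u ≡ v) →
    ¬ Embedding (startCentralStar (suc t)) (blockColouring block) colour₂
  blockColouring-¬star position jointly-injective f
    with i , j , i<j , eq ← Fin.pigeonhole (n<1+n _) (position ∘ φ f) =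
    Fin.<⇒≢ i<j (injective f (jointly-injective (trans (sym (centre i)) (centre j)) eq))
    where
    centre : ∀ v → block (φ f Fin.zero) ≡ block (φ f v)
    centre Fin.zero    = refl
    centre (Fin.suc v) = colour₂⇒≡ (edge f {Fin.zero} {Fin.suc v} arm) (coloured f arm)
      where
      arm : Adj (startCentralStar _) Fin.zero (Fin.suc v)
      arm = inj₁ (refl , s≤s z≤n)

orderedRamseyProperty⇒< : ∀ s t → OrderedRamseyProperty (K (suc s)) (startCentralStar (suc t)) n → s * t < n
orderedRamseyProperty⇒< {n} s t ramsey = ≰⇒> λ n≤st →
  let
    cell : Fin n → Fin (s * t)
    cell u = inject≤ u n≤st
    -- Division by `t` identifies `Fin (s * t)` with `Fin s × Fin t`: the quotient is the block, the
    -- remainder the position in it, and `combine` recovers the cell from both.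
    block = quotient {s} t ∘ cell
    cell-injective : ∀ {u v} → block u ≡ block v → remainder {s} t (cell u) ≡ remainder {s} t (cell v) → u ≡ v
    cell-injective {u} {v} eq₁ eq₂ = Fin.inject≤-injective n≤st n≤st u v
      (trans (sym (Fin.combine-remQuot {s} t (cell u)))
        (trans (cong₂ Fin.combine eq₁ eq₂) (Fin.combine-remQuot {s} t (cell v))))
  in [ blockColouring-¬K block (n<1+n s) ∘ proj₁
     , blockColouring-¬star block (remainder {s} t ∘ cell) cell-injective ∘ proj₁
     ]′ (ramsey (blockColouring block))

theorem4p24 : (a b : ℕ) → 1 ≤ a → 1 ≤ b →
    R-ord[ K a , startCentralStar b ]≡ (1 + (a ∸ 1) * (b ∸ 1))
theorem4p24 (suc s) (suc t) _ _ =
  -- Both bounds use the condition `s * t < n`, whose least solution is `1 + s * t`.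
  orderedRamseyProperty {s} {t} (n<1+n _) , λ _ → orderedRamseyProperty⇒< s t
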